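{- Let $\mathbf{A} \in \mathsf{CIdInRL}$ and $x \in A$. Then $\langle B_x, \cdot, \vee, -, 0_x, 1_x \rangle$ is a Boolean algebra (with meet $\cdot$, join $\vee$, complement $-$, bottom $0_x$ and top $1_x$).
   Context: A commutative idempotent involutive residuated lattice is an algebra $\mathbf{A}=\langle A,\wedge,\vee,\cdot,\to,1,0\rangle$ such that $\langle A,\wedge,\vee\rangle$ is a lattice (with lattice order $\leq$), $\langle A,\cdot,1\rangle$ is a commutative monoid with $x\cdot x=x$ for all $x$, residuation holds ($x\cdot y\leq z \iff y\leq x\to z$), and, writing $-x := x\to 0$, one has $-{ - }x=x$ for all $x$. The class of these algebras is $\mathsf{CIdInRL}$. The monoidal order is $x\sqsubseteq y :\Leftrightarrow x\cdot y=x$. For $x\in A$ put $1_x := x\vee -x$, $0_x := x\wedge -x$, and $B_x := \{y\in A \mid 0_x\sqsubseteq y\sqsubseteq 1_x\}$. One-element Boolean algebras are allowed. -}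

module Defs where

open import Algebra.Core using (Op₁; Op₂)
import Algebra.Definitions as Definitions
open import Algebra.Lattice.Structures using (IsLattice; IsBooleanAlgebra)
open import Algebra.Structures using (IsIdempotentCommutativeMonoid)
open import Data.Product using (∃; _×_; _,_; proj₁)
open import Function.Base using (_on_)
open import Function.Bundles using (_⇔_)
open import Level using (suc; _⊔_)
open import Relation.Binary.Core using (Rel)
import Relation.Binary.Construct.NaturalOrder.Left as NaturalOrder
open import Relation.Unary using (Pred; _∈_)

-- Congruence of _⇒_ is not a field because residuation and antisymmetry of
-- the lattice order imply it.
record CIdInRL c ℓ : Set (suc (c ⊔ ℓ)) where
  infix  9 -_
  infixl 8 _∙_
  infixr 7 _∧_
  infixr 6 _∨_
  infixr 5 _⇒_
  infix  4 _≈_ _⊑_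
  field
    Carrier : Set c
    _≈_     : Rel Carrier ℓ
    _∧_     : Op₂ Carrier
    _∨_     : Op₂ Carrier
    _∙_     : Op₂ Carrier
    _⇒_     : Op₂ Carrier
    1#      : Carrier
    0#      : Carrier

  open Definitions _≈_
  open NaturalOrder _≈_ _∧_ public using (_≤_)

  -_ : Op₁ Carrier
  - x = x ⇒ 0#

  field
    isLattice  : IsLattice _≈_ _∨_ _∧_
    ∙-cong     : Congruent₂ _∙_
    ∙-assoc    : Associative _∙_
    ∙-identity : Identity 1# _∙_
    ∙-comm     : Commutative _∙_
    ∙-idem     : Idempotent _∙_
    residuated : ∀ x y z → (x ∙ y ≤ z) ⇔ (y ≤ (x ⇒ z))
    involutive : ∀ x → - (- x) ≈ x

  open IsLattice isLattice public

  ∙-isIdempotentCommutativeMonoid : IsIdempotentCommutativeMonoid _≈_ _∙_ 1#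
  ∙-isIdempotentCommutativeMonoid = record
    { isCommutativeMonoid = record
      { isMonoid = record
        { isSemigroup = record
          { isMagma = record
            { isEquivalence = isEquivalence
            ; ∙-cong        = ∙-cong
            }
          ; assoc = ∙-assoc
          }
        ; identity = ∙-identity
        }
      ; comm = ∙-comm
      }
    ; idem = ∙-idem
    }

  _⊑_ : Rel Carrier ℓ
  x ⊑ y = x ∙ y ≈ x

  1[_] : Carrier → Carrier
  1[ x ] = x ∨ - x

  0[_] : Carrier → Carrier
  0[ x ] = x ∧ - x

  B : Carrier → Pred Carrier ℓ
  B x y = (0[ x ] ⊑ y) × (y ⊑ 1[ x ])

-- The subset P contains ⊤ and ⊥, is closed under the operations, and forms
-- a Boolean algebra under their restrictions.  Elements of the subset are
-- compared in the ambient carrier, ignoring the proofs of membership.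
record IsBooleanAlgebraOn {a ℓ p} {A : Set a} (_≈_ : Rel A ℓ) (P : Pred A p)
                          (_∨_ _∧_ : Op₂ A) (¬_ : Op₁ A) (⊤ ⊥ : A)
                          : Set (a ⊔ ℓ ⊔ p) where
  field
    ∨-closed : ∀ {y z} → y ∈ P → z ∈ P → (y ∨ z) ∈ P
    ∧-closed : ∀ {y z} → y ∈ P → z ∈ P → (y ∧ z) ∈ P
    ¬-closed : ∀ {y} → y ∈ P → (¬ y) ∈ P
    ⊤-closed : ⊤ ∈ P
    ⊥-closed : ⊥ ∈ P
    isBooleanAlgebra : IsBooleanAlgebra {A = ∃ P} (_≈_ on proj₁)
      (λ (y , y∈P) (z , z∈P) → (y ∨ z) , ∨-closed y∈P z∈P)
      (λ (y , y∈P) (z , z∈P) → (y ∧ z) , ∧-closed y∈P z∈P)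
      (λ (y , y∈P) → (¬ y) , ¬-closed y∈P)
      (⊤ , ⊤-closed)
      (⊥ , ⊥-closed)

{-# OPTIONS --safe #-}

-- By involutivity, y ≤ z holds iff y ∙ - z ≤ 0#, so every inequality below
-- reduces to a product lying under 0#.  Since 0[ x ] ≤ 0#, every y ∈ B x
-- satisfies 0[ x ] ≤ y ≤ 1[ x ] also in the lattice order.  As 1[ x ] = - 0[ x ],
-- this makes B x closed under - and forces y ∙ - y = 0[ x ] for all y ∈ B x;
-- absorption for ∙ and ∨ follows, and ∙ distributes over ∨ by residuation.
module Submission where

open import Algebra.Consequences.Setoid using (comm∧distrˡ⇒distr)
open import Algebra.Core using (Op₂)
import Algebra.Definitions as Definitions
open import Algebra.Lattice.Bundles using (Lattice)
import Algebra.Lattice.Properties.DistributiveLattice as DistributiveLatticeProperties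
import Algebra.Lattice.Properties.Lattice as LatticeProperties
open import Algebra.Lattice.Structures using (IsLattice; IsDistributiveLattice; IsBooleanAlgebra)
open import Algebra.Lattice.Structures.Biased using (isDistributiveLatticeʳʲᵐ; isBooleanAlgebraʳ)
open import Data.Product using (∃; _,_; proj₁; proj₂)
open import Function.Base using (_on_)
open import Function.Bundles using (module Equivalence)
open import Relation.Binary.Core using (Rel)
import Relation.Binary.Construct.On as On
import Relation.Binary.Lattice as OrderTheoretic
import Relation.Binary.Reasoning.PartialOrder as PosetReasoning
import Relation.Binary.Reasoning.Setoid as SetoidReasoning
open import Relation.Unary using (_∈_)

open import Defs

module CIdInRLProperties {c ℓ} (𝐀 : CIdInRL c ℓ) where
  open CIdInRL 𝐀
  open Definitions _≈_

  lattice : Lattice c ℓ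
  lattice = record { isLattice = isLattice }

  open Lattice lattice using (setoid)
  open LatticeProperties lattice using (∨-idem; ∨-∧-orderTheoreticLattice)
  open OrderTheoretic.Lattice ∨-∧-orderTheoreticLattice
    using (poset; antisym; x≤x∨y; y≤x∨y; ∨-least; x∧y≤x; x∧y≤y; ∧-greatest)
    renaming (refl to ≤-refl; trans to ≤-trans; reflexive to ≤-reflexive)

  -- Residuation, monotonicity and joins

  residuate : ∀ {x y z} → x ∙ y ≤ z → y ≤ (x ⇒ z)
  residuate = Equivalence.to (residuated _ _ _)

  unresiduate : ∀ {x y z} → y ≤ (x ⇒ z) → x ∙ y ≤ z
  unresiduate = Equivalence.from (residuated _ _ _)

  ∙-congˡ : LeftCongruent _∙_
  ∙-congˡ = ∙-cong refl

  ∙-congʳ : RightCongruent _∙_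
  ∙-congʳ eq = ∙-cong eq refl

  ∙-monoʳ : ∀ x {y z} → y ≤ z → x ∙ y ≤ x ∙ z
  ∙-monoʳ x y≤z = unresiduate (≤-trans y≤z (residuate ≤-refl))

  ∙-mono : ∀ {w x y z} → w ≤ x → y ≤ z → w ∙ y ≤ x ∙ z
  ∙-mono {w} {x} {y} {z} w≤x y≤z = begin
    w ∙ y ≤⟨ ∙-monoʳ w y≤z ⟩
    w ∙ z ≈⟨ ∙-comm w z ⟩
    z ∙ w ≤⟨ ∙-monoʳ z w≤x ⟩
    z ∙ x ≈⟨ ∙-comm z x ⟩
    x ∙ z ∎
    where open PosetReasoning poset

  -- Idempotence replaces `x` by `x ∙ x`. Together with `∙-lub` this places every product between
  -- the meet and the join of its factors.
  ∙-glb : ∀ {x y z} → x ≤ y → x ≤ z → x ≤ y ∙ z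
  ∙-glb {x} x≤y x≤z = ≤-trans (≤-reflexive (sym (∙-idem x))) (∙-mono x≤y x≤z)

  ∙-lub : ∀ {x y z} → x ≤ z → y ≤ z → x ∙ y ≤ z
  ∙-lub {z = z} x≤z y≤z = ≤-trans (∙-mono x≤z y≤z) (≤-reflexive (∙-idem z))

  -- By residuation, multiplication by `x` is a left adjoint, so it preserves joins.
  ∙-distribˡ-∨ : _∙_ DistributesOverˡ _∨_
  ∙-distribˡ-∨ x y z = antisym
    (unresiduate (∨-least (residuate (x≤x∨y _ _)) (residuate (y≤x∨y _ _))))
    (∨-least (∙-monoʳ x (x≤x∨y y z)) (∙-monoʳ x (y≤x∨y y z)))

  ∙-distribʳ-∨ : _∙_ DistributesOverʳ _∨_
  ∙-distribʳ-∨ = proj₂ (comm∧distrˡ⇒distr setoid ∨-cong ∙-comm ∙-distribˡ-∨)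

  -- Negation as an antitone involution

  x∙-x≤0 : ∀ x → x ∙ - x ≤ 0#
  x∙-x≤0 x = unresiduate ≤-refl

  x∙-y≤0⇒x≤y : ∀ {x y} → x ∙ - y ≤ 0# → x ≤ y
  x∙-y≤0⇒x≤y {x} {y} x∙-y≤0 = ≤-trans
    (residuate (≤-trans (≤-reflexive (∙-comm (- y) x)) x∙-y≤0))
    (≤-reflexive (involutive y))

  -‿anti : ∀ {x y} → x ≤ y → - y ≤ - x
  -‿anti {x} {y} x≤y = residuate (≤-trans (∙-mono x≤y ≤-refl) (x∙-x≤0 y))

  -‿cong : Congruent₁ -_
  -‿cong x≈y = antisym (-‿anti (≤-reflexive (sym x≈y))) (-‿anti (≤-reflexive x≈y))

  x≤-y⇒y≤-x : ∀ {x y} → x ≤ - y → y ≤ - x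
  x≤-y⇒y≤-x {x} {y} x≤-y = ≤-trans (≤-reflexive (sym (involutive y))) (-‿anti x≤-y)

  -x≤y⇒-y≤x : ∀ {x y} → - x ≤ y → - y ≤ x
  -x≤y⇒-y≤x {x} {y} -x≤y = ≤-trans (-‿anti -x≤y) (≤-reflexive (involutive x))

  -- The bounds `0[ x ]` and `1[ x ]`

  0[x]≤0 : ∀ x → 0[ x ] ≤ 0#
  0[x]≤0 x = ≤-trans (∙-glb (x∧y≤x _ _) (x∧y≤y _ _)) (x∙-x≤0 x)

  -- De Morgan: an antitone involution turns the meet of `x` and `- x` into the join of `- x` and
  -- `x`.
  -0[x]≈1[x] : ∀ x → - 0[ x ] ≈ 1[ x ]
  -0[x]≈1[x] x = antisym
    (-x≤y⇒-y≤x (∧-greatest (-x≤y⇒-y≤x (y≤x∨y _ _)) (-‿anti (x≤x∨y _ _))))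
    (∨-least (x≤-y⇒y≤-x (x∧y≤y _ _)) (-‿anti (x∧y≤x _ _)))

  1≤1[x] : ∀ x → 1# ≤ 1[ x ]
  1≤1[x] x = ≤-trans
    (residuate (≤-trans (≤-reflexive (proj₂ ∙-identity _)) (0[x]≤0 x)))
    (≤-reflexive (-0[x]≈1[x] x))

  -- Idempotence absorbs the second factor `- x`. Taken at `0[ x ]`, whose negation is `1[ x ]`,
  -- this gives the harder half of `0[x]⊑1[x]`.
  x∙-x≤x : ∀ x → x ∙ - x ≤ x
  x∙-x≤x x = x∙-y≤0⇒x≤y (begin
    (x ∙ - x) ∙ - x ≈⟨ ∙-assoc x (- x) (- x) ⟩
    x ∙ (- x ∙ - x) ≈⟨ ∙-congˡ (∙-idem (- x)) ⟩
    x ∙ - x         ≤⟨ x∙-x≤0 x ⟩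
    0#              ∎)
    where open PosetReasoning poset

  0[x]≤1[x] : ∀ x → 0[ x ] ≤ 1[ x ]
  0[x]≤1[x] x = ≤-trans (x∧y≤x _ _) (x≤x∨y _ _)

  0[x]⊑1[x] : ∀ x → 0[ x ] ⊑ 1[ x ]
  0[x]⊑1[x] x = antisym
    (≤-trans (≤-reflexive (∙-congˡ (sym (-0[x]≈1[x] x)))) (x∙-x≤x 0[ x ]))
    (∙-glb ≤-refl (0[x]≤1[x] x))

  -- Closure of `B x` under the operations

  module _ {x : Carrier} where

    0∈B : 0[ x ] ∈ B x
    0∈B = ∙-idem _ , 0[x]⊑1[x] x

    1∈B : 1[ x ] ∈ B x
    1∈B = 0[x]⊑1[x] x , ∙-idem _

    ∙-closed : ∀ {y z} → y ∈ B x → z ∈ B x → y ∙ z ∈ B x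
    ∙-closed {y} {z} (0⊑y , _) (0⊑z , z⊑1) =
        trans (sym (∙-assoc _ y z)) (trans (∙-congʳ 0⊑y) 0⊑z)
      , trans (∙-assoc y z _) (∙-congˡ z⊑1)

    ∨-closed : ∀ {y z} → y ∈ B x → z ∈ B x → y ∨ z ∈ B x
    ∨-closed {y} {z} (0⊑y , y⊑1) (0⊑z , z⊑1) =
        trans (∙-distribˡ-∨ _ y z) (trans (∨-cong 0⊑y 0⊑z) (∨-idem _))
      , trans (∙-distribʳ-∨ _ y z) (∨-cong y⊑1 z⊑1)

    y∈B⇒0≤y : ∀ {y} → y ∈ B x → 0[ x ] ≤ y
    y∈B⇒0≤y {y} (0⊑y , _) = x∙-y≤0⇒x≤y (begin
      -- Since `0[ x ]` absorbs `y`, a factor `y` can be inserted to meet `- y`.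
      0[ x ] ∙ - y       ≈⟨ ∙-congʳ 0⊑y ⟨
      (0[ x ] ∙ y) ∙ - y ≈⟨ ∙-assoc _ y (- y) ⟩
      0[ x ] ∙ (y ∙ - y) ≤⟨ ∙-lub (0[x]≤0 x) (x∙-x≤0 y) ⟩
      0#                 ∎)
      where open PosetReasoning poset

    y∈B⇒0≤-y : ∀ {y} → y ∈ B x → 0[ x ] ≤ - y
    y∈B⇒0≤-y {y} (0⊑y , _) =
      residuate (≤-trans (≤-reflexive (trans (∙-comm y _) 0⊑y)) (0[x]≤0 x))

    -- The factor `1[ x ]` can be moved onto `y`, which absorbs it, so `- y ∙ 1[ x ]` still lies
    -- under `- y`; the other direction comes from `1# ≤ 1[ x ]`.
    ⊑1⇒-y⊑1 : ∀ {y} → y ⊑ 1[ x ] → - y ⊑ 1[ x ]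
    ⊑1⇒-y⊑1 {y} y⊑1 = antisym (residuate y∙[-y∙1]≤0) (begin
      - y          ≈⟨ proj₂ ∙-identity (- y) ⟨
      - y ∙ 1#     ≤⟨ ∙-monoʳ (- y) (1≤1[x] x) ⟩
      - y ∙ 1[ x ] ∎)
      where
      open PosetReasoning poset
      y∙[-y∙1]≤0 : y ∙ (- y ∙ 1[ x ]) ≤ 0#
      y∙[-y∙1]≤0 = begin
        y ∙ (- y ∙ 1[ x ]) ≈⟨ ∙-congˡ (∙-comm (- y) _) ⟩
        y ∙ (1[ x ] ∙ - y) ≈⟨ ∙-assoc y _ (- y) ⟨
        (y ∙ 1[ x ]) ∙ - y ≈⟨ ∙-congʳ y⊑1 ⟩
        y ∙ - y            ≤⟨ x∙-x≤0 y ⟩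
        0#                 ∎

    -- Multiplying by `- 0[ x ]`, which is `1[ x ]`, changes nothing because `- y` absorbs it. The
    -- case `z = 0[ x ]` serves closure under `-`, and `z = y` the complement law.
    z∙-y≤0⇒z∙-y≤0[x] : ∀ {y z} → y ⊑ 1[ x ] → z ∙ - y ≤ 0# → z ∙ - y ≤ 0[ x ]
    z∙-y≤0⇒z∙-y≤0[x] {y} {z} y⊑1 z∙-y≤0 = x∙-y≤0⇒x≤y (begin
      (z ∙ - y) ∙ - 0[ x ] ≈⟨ ∙-assoc z (- y) _ ⟩
      z ∙ (- y ∙ - 0[ x ]) ≈⟨ ∙-congˡ (∙-congˡ (-0[x]≈1[x] x)) ⟩
      z ∙ (- y ∙ 1[ x ])   ≈⟨ ∙-congˡ (⊑1⇒-y⊑1 y⊑1) ⟩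
      z ∙ - y              ≤⟨ z∙-y≤0 ⟩
      0#                   ∎)
      where open PosetReasoning poset

    -‿closed : ∀ {y} → y ∈ B x → - y ∈ B x
    -‿closed {y} y∈B@(_ , y⊑1) =
        antisym
          (z∙-y≤0⇒z∙-y≤0[x] y⊑1 (≤-trans (∙-mono (y∈B⇒0≤y y∈B) ≤-refl) (x∙-x≤0 y)))
          (∙-glb ≤-refl (y∈B⇒0≤-y y∈B))
      , ⊑1⇒-y⊑1 y⊑1

    -- Complement and absorption laws

    y∙-y≈0[x] : ∀ {y} → y ∈ B x → y ∙ - y ≈ 0[ x ]
    y∙-y≈0[x] {y} y∈B@(_ , y⊑1) = antisym
      (z∙-y≤0⇒z∙-y≤0[x] y⊑1 (x∙-x≤0 y))
      (∙-glb (y∈B⇒0≤y y∈B) (y∈B⇒0≤-y y∈B))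

    0[y]≈0[x] : ∀ {y} → y ∈ B x → 0[ y ] ≈ 0[ x ]
    0[y]≈0[x] {y} y∈B = antisym
      (≤-trans (∙-glb (x∧y≤x _ _) (x∧y≤y _ _)) (≤-reflexive (y∙-y≈0[x] y∈B)))
      (∧-greatest (y∈B⇒0≤y y∈B) (y∈B⇒0≤-y y∈B))

    -- As `1[ y ]` unfolds to `y ∨ - y`, this is the complement law for joins, obtained by negating
    -- the equality of the bottoms.
    1[y]≈1[x] : ∀ {y} → y ∈ B x → 1[ y ] ≈ 1[ x ]
    1[y]≈1[x] {y} y∈B = begin
      1[ y ]   ≈⟨ -0[x]≈1[x] y ⟨
      - 0[ y ] ≈⟨ -‿cong (0[y]≈0[x] y∈B) ⟩
      - 0[ x ] ≈⟨ -0[x]≈1[x] x ⟩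
      1[ x ]   ∎
      where open SetoidReasoning setoid

    -- Multiplying by `- y` collapses `y` to `0[ x ]`, which absorbs `z`. Both absorption laws rest
    -- on this inequality.
    y∙z≤y : ∀ {y z} → y ∈ B x → z ∈ B x → y ∙ z ≤ y
    y∙z≤y {y} {z} y∈B (0⊑z , _) = x∙-y≤0⇒x≤y (begin
      (y ∙ z) ∙ - y ≈⟨ ∙-congʳ (∙-comm y z) ⟩
      (z ∙ y) ∙ - y ≈⟨ ∙-assoc z y (- y) ⟩
      z ∙ (y ∙ - y) ≈⟨ ∙-congˡ (y∙-y≈0[x] y∈B) ⟩
      z ∙ 0[ x ]    ≈⟨ ∙-comm z _ ⟩
      0[ x ] ∙ z    ≈⟨ 0⊑z ⟩
      0[ x ]        ≤⟨ 0[x]≤0 x ⟩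
      0#            ∎)
      where open PosetReasoning poset

    ∨-absorbs-∙ : ∀ {y z} → y ∈ B x → z ∈ B x → y ∨ (y ∙ z) ≈ y
    ∨-absorbs-∙ y∈B z∈B = antisym (∨-least ≤-refl (y∙z≤y y∈B z∈B)) (x≤x∨y _ _)

    ∙-absorbs-∨ : ∀ {y z} → y ∈ B x → z ∈ B x → y ∙ (y ∨ z) ≈ y
    ∙-absorbs-∨ {y} {z} y∈B z∈B = begin
      y ∙ (y ∨ z)     ≈⟨ ∙-distribˡ-∨ y y z ⟩
      (y ∙ y) ∨ y ∙ z ≈⟨ ∨-congʳ (∙-idem y) ⟩
      y ∨ y ∙ z       ≈⟨ ∨-absorbs-∙ y∈B z∈B ⟩
      y               ∎
      where open SetoidReasoning setoid

  -- Assembling the Boolean algebra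

  module Interval (x : Carrier) where

    infixr 6 _∨ᴮ_
    infixl 8 _∙ᴮ_

    _≈ᴮ_ : Rel (∃ (B x)) ℓ
    _≈ᴮ_ = _≈_ on proj₁

    _∨ᴮ_ _∙ᴮ_ : Op₂ (∃ (B x))
    (y , y∈B) ∨ᴮ (z , z∈B) = y ∨ z , ∨-closed y∈B z∈B
    (y , y∈B) ∙ᴮ (z , z∈B) = y ∙ z , ∙-closed y∈B z∈B

    -- The lattice is built upside down, with `∙` in the join slot, so that `∙-distribʳ-∨` is
    -- exactly the law of join over meet that `isDistributiveLatticeʳʲᵐ` expects.
    ∙-∨-isLatticeᴮ : IsLattice _≈ᴮ_ _∙ᴮ_ _∨ᴮ_
    ∙-∨-isLatticeᴮ = record
      { isEquivalence = On.isEquivalence proj₁ isEquivalence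
      ; ∨-comm        = λ _ _ → ∙-comm _ _
      ; ∨-assoc       = λ _ _ _ → ∙-assoc _ _ _
      ; ∨-cong        = ∙-cong
      ; ∧-comm        = λ _ _ → ∨-comm _ _
      ; ∧-assoc       = λ _ _ _ → ∨-assoc _ _ _
      ; ∧-cong        = ∨-cong
      ; absorptive    = (λ (_ , y∈B) (_ , z∈B) → ∙-absorbs-∨ y∈B z∈B)
                      , (λ (_ , y∈B) (_ , z∈B) → ∨-absorbs-∙ y∈B z∈B)
      }

    ∙-∨-isDistributiveLatticeᴮ : IsDistributiveLattice _≈ᴮ_ _∙ᴮ_ _∨ᴮ_
    ∙-∨-isDistributiveLatticeᴮ = isDistributiveLatticeʳʲᵐ (record
      { isLattice    = ∙-∨-isLatticeᴮ
      ; ∨-distribʳ-∧ = λ _ _ _ → ∙-distribʳ-∨ _ _ _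
      })

    isBooleanAlgebraᴮ : IsBooleanAlgebra _≈ᴮ_ _∨ᴮ_ _∙ᴮ_
      (λ (y , y∈B) → - y , -‿closed y∈B) (1[ x ] , 1∈B) (0[ x ] , 0∈B)
    isBooleanAlgebraᴮ = isBooleanAlgebraʳ (record
      { isDistributiveLattice =
          -- Dualising restores `∨` as join and `∙` as meet.
          DistributiveLatticeProperties.∧-∨-isDistributiveLattice
            (record { isDistributiveLattice = ∙-∨-isDistributiveLatticeᴮ })
      ; ∨-complementʳ = λ (_ , y∈B) → 1[y]≈1[x] y∈B
      ; ∧-complementʳ = λ (_ , y∈B) → y∙-y≈0[x] y∈B
      ; ¬-cong        = -‿cong
      })

theorem3p3 : ∀ {c ℓ} (𝐀 : CIdInRL c ℓ) → let open CIdInRL 𝐀 in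
    ∀ (x : Carrier) → IsBooleanAlgebraOn _≈_ (B x) _∨_ _∙_ -_ 1[ x ] 0[ x ]
theorem3p3 𝐀 x = record
  { ∨-closed         = ∨-closed
  ; ∧-closed         = ∙-closed
  ; ¬-closed         = -‿closed
  ; ⊤-closed         = 1∈B
  ; ⊥-closed         = 0∈B
  ; isBooleanAlgebra = isBooleanAlgebraᴮ
  }
  where
  open CIdInRLProperties 𝐀
  open Interval x
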